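{- For all positive integers $k,n$, $$\sum_{i=1}^{n}M_i^{(k)}=\frac{2^kM_n^{(k)}-n}{M_k} .$$
   Context: The Mersenne numbers $\{M_n\}_{n\ge 0}$ are defined by $M_0=0$, $M_1=1$, $M_{n+2}=3M_{n+1}-2M_n$, i.e. $M_n=2^n-1$. For a positive integer $k$, the higher order Mersenne numbers are $M_n^{(k)}=M_{kn}/M_k$ for $n=0,1,2,\dots$. -}

module Defs where

open import Data.Nat as ℕ using (ℕ; zero; suc)
import Data.Nat.Properties as ℕ
open import Data.Integer as ℤ using (ℤ; +_; 0ℤ; 1ℤ)
import Data.Integer.Properties as ℤ
open import Data.Integer.Tactic.RingSolver using (solve-∀)
open import Data.Rational as ℚ using (ℚ)
open import Data.Rational.Literals using (fromℤ)
open import Data.Sum using (inj₁; inj₂)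
open import Relation.Binary.PropositionalEquality

M : ℕ → ℤ
M zero          = 0ℤ
M (suc zero)    = 1ℤ
M (suc (suc n)) = + 3 ℤ.* M (suc n) ℤ.- + 2 ℤ.* M n

M-closed : ∀ n → M n ≡ + (2 ℕ.^ n) ℤ.- 1ℤ
M-closed zero          = refl
M-closed (suc zero)    = refl
M-closed (suc (suc n)) = begin
  + 3 ℤ.* M (suc n) ℤ.- + 2 ℤ.* M n
    ≡⟨ cong₂ (λ a b → + 3 ℤ.* a ℤ.- + 2 ℤ.* b) (M-closed (suc n)) (M-closed n) ⟩
  + 3 ℤ.* (+ (2 ℕ.* p) ℤ.- 1ℤ) ℤ.- + 2 ℤ.* (+ p ℤ.- 1ℤ)
    ≡⟨ cong (λ a → + 3 ℤ.* (a ℤ.- 1ℤ) ℤ.- + 2 ℤ.* (+ p ℤ.- 1ℤ)) (ℤ.pos-* 2 p) ⟩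
  + 3 ℤ.* (+ 2 ℤ.* + p ℤ.- 1ℤ) ℤ.- + 2 ℤ.* (+ p ℤ.- 1ℤ)
    ≡⟨ ring (+ p) ⟩
  + 2 ℤ.* (+ 2 ℤ.* + p) ℤ.- 1ℤ
    ≡⟨ cong (λ a → + 2 ℤ.* a ℤ.- 1ℤ) (ℤ.pos-* 2 p) ⟨
  + 2 ℤ.* + (2 ℕ.* p) ℤ.- 1ℤ
    ≡⟨ cong (ℤ._- 1ℤ) (ℤ.pos-* 2 (2 ℕ.* p)) ⟨
  + (2 ℕ.* (2 ℕ.* p)) ℤ.- 1ℤ ∎
  where
  open ≡-Reasoning
  p = 2 ℕ.^ n
  ring : ∀ x → + 3 ℤ.* (+ 2 ℤ.* x ℤ.- 1ℤ) ℤ.- + 2 ℤ.* (x ℤ.- 1ℤ) ≡ + 2 ℤ.* (+ 2 ℤ.* x) ℤ.- 1ℤ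
  ring = solve-∀

M≢0 : ∀ k .{{_ : ℕ.NonZero k}} → M k ≢ 0ℤ
M≢0 k@(suc _) Mk≡0
  with ℕ.m^n≡1⇒n≡0∨m≡1 2 k
         (ℤ.+-injective (ℤ.i-j≡0⇒i≡j (+ (2 ℕ.^ k)) 1ℤ (trans (sym (M-closed k)) Mk≡0)))
... | inj₁ ()
... | inj₂ ()

M-nonZero : ∀ k .{{_ : ℕ.NonZero k}} → ℚ.NonZero (fromℤ (M k))
M-nonZero k = ℤ.≢-nonZero (M≢0 k)

-- The quotient is taken in ℚ, so no divisibility of M (k * n) by M k is presupposed.
M⁽_⁾ : (k : ℕ) .{{_ : ℕ.NonZero k}} → ℕ → ℚ
M⁽ k ⁾ n = (fromℤ (M (k ℕ.* n)) ℚ.÷ fromℤ (M k)) {{M-nonZero k}}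

{-# OPTIONS --safe #-}
-- With p = 2^k, a_i = M_{ki} and G_i the right-hand side for n = i, the identity
-- p (a_{i+1} − a_i) = M_k (a_{i+1} + 1) gives G_{i+1} − G_i = a_{i+1} / M_k, so the sum telescopes.
module Submission where

open import Defs
open import Data.Fin using (toℕ)
open import Data.Nat as ℕ using (ℕ; zero; suc)
import Data.Nat.Properties as ℕ
open import Data.Integer as ℤ using (+_; 1ℤ)
import Data.Integer.Properties as ℤ
import Data.Integer.Tactic.RingSolver as ℤ-Solver
open import Data.Rational as ℚ using (ℚ; 0ℚ; 1ℚ; _+_; _*_; _-_; _÷_; 1/_)
import Data.Rational.Properties as ℚ
import Data.Rational.Unnormalised as ℚᵘ
import Data.Rational.Unnormalised.Properties as ℚᵘ
open import Data.Rational.Literals using (fromℤ)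
open import Data.Rational.Properties using (+-0-commutativeMonoid)
open import Data.Rational.Solver using (module +-*-Solver)
open import Algebra.Properties.CommutativeMonoid.Sum +-0-commutativeMonoid using (sum-syntax; sum-cong-≗)
open import Relation.Binary.PropositionalEquality

open ≡-Reasoning
open +-*-Solver using (solve; con; _:+_; _:*_; _:-_; _:=_)

-- Put `x = 2^(kj)`, so that `a_j = x - 1` and `a_{j+1} = px - 1`, while `M k = p - 1`. Both sides
-- of the key identity (`M-step`) are then `(p - 1)px`. Dividing it by the square of `M k` shows
-- that the `p`-term of `G` grows by `(a_{j+1} + 1) / M k`. The subtracted index grows by one and
-- takes away the surplus `1 / M k` (`÷-difference`). As `G 0 = 0`, telescoping leaves `G n`.

fromℤ-+ : ∀ i j → fromℤ (i ℤ.+ j) ≡ fromℤ i + fromℤ j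
fromℤ-+ i j = ℚ.toℚᵘ-injective (ℚᵘ.≃-trans
  -- Among unnormalised rationals no gcd is cancelled; all denominators are 1, so cross-multiplying
  -- leaves an integer identity.
  (ℚᵘ.*≡* (ring i j))
  (ℚᵘ.≃-sym (ℚ.toℚᵘ-homo-+ (fromℤ i) (fromℤ j))))
  where
  ring : ∀ i j → (i ℤ.+ j) ℤ.* 1ℤ ≡ (i ℤ.* 1ℤ ℤ.+ j ℤ.* 1ℤ) ℤ.* 1ℤ
  ring = ℤ-Solver.solve-∀

fromℤ-* : ∀ i j → fromℤ (i ℤ.* j) ≡ fromℤ i * fromℤ j
fromℤ-* i j = ℚ.toℚᵘ-injective (ℚᵘ.≃-trans
  (ℚᵘ.*≡* refl)
  (ℚᵘ.≃-sym (ℚ.toℚᵘ-homo-* (fromℤ i) (fromℤ j))))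

-- `G` is arbitrary because the sum unfolds at its first term, so the induction hypothesis is needed
-- for the shifted sequence.
∑-telescope : ∀ (G : ℕ → ℚ) n → ∑[ i < n ] (G (suc (toℕ i)) - G (toℕ i)) ≡ G n - G 0
∑-telescope G zero    = sym (ℚ.+-inverseʳ (G 0))
∑-telescope G (suc n) = begin
  (G 1 - G 0) + ∑[ i < n ] (G (suc (suc (toℕ i))) - G (suc (toℕ i)))
    ≡⟨ cong (_+_ (G 1 - G 0)) (∑-telescope (λ i → G (suc i)) n) ⟩
  (G 1 - G 0) + (G (suc n) - G 1)
    ≡⟨ solve 3 (λ x y z → (y :- x) :+ (z :- y) := z :- x) refl (G 0) (G 1) (G (suc n)) ⟩
  G (suc n) - G 0 ∎

fromℤ-M : ∀ n → fromℤ (M n) ≡ fromℤ (+ (2 ℕ.^ n)) - 1ℚ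
fromℤ-M n = trans (cong fromℤ (M-closed n)) (fromℤ-+ (+ (2 ℕ.^ n)) (ℤ.- 1ℤ))

fromℤ-2^-*-suc : ∀ k n → fromℤ (+ (2 ℕ.^ (k ℕ.* suc n))) ≡ fromℤ (+ (2 ℕ.^ k)) * fromℤ (+ (2 ℕ.^ (k ℕ.* n)))
fromℤ-2^-*-suc k n = begin
  fromℤ (+ (2 ℕ.^ (k ℕ.* suc n)))
    ≡⟨ cong (λ e → fromℤ (+ (2 ℕ.^ e))) (ℕ.*-suc k n) ⟩
  fromℤ (+ (2 ℕ.^ (k ℕ.+ k ℕ.* n)))
    ≡⟨ cong (λ e → fromℤ (+ e)) (ℕ.^-distribˡ-+-* 2 k (k ℕ.* n)) ⟩
  fromℤ (+ (2 ℕ.^ k ℕ.* 2 ℕ.^ (k ℕ.* n)))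
    ≡⟨ cong fromℤ (ℤ.pos-* (2 ℕ.^ k) (2 ℕ.^ (k ℕ.* n))) ⟩
  fromℤ (+ (2 ℕ.^ k) ℤ.* + (2 ℕ.^ (k ℕ.* n)))
    ≡⟨ fromℤ-* (+ (2 ℕ.^ k)) (+ (2 ℕ.^ (k ℕ.* n))) ⟩
  fromℤ (+ (2 ℕ.^ k)) * fromℤ (+ (2 ℕ.^ (k ℕ.* n))) ∎

M-step : ∀ k n → fromℤ (+ (2 ℕ.^ k)) * (fromℤ (M (k ℕ.* suc n)) - fromℤ (M (k ℕ.* n)))
               ≡ fromℤ (M k) * (fromℤ (M (k ℕ.* suc n)) + 1ℚ)
M-step k n = step (fromℤ (+ (2 ℕ.^ k))) (fromℤ (+ (2 ℕ.^ (k ℕ.* n)))) (fromℤ-M k) (fromℤ-M (k ℕ.* n))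
  (trans (fromℤ-M (k ℕ.* suc n)) (cong (_- 1ℚ) (fromℤ-2^-*-suc k n)))
  where
  -- With `m`, `a`, `b` as variables, matching on `refl` eliminates them and leaves a polynomial
  -- identity in `p` and `x`.
  step : ∀ p x {m a b} → m ≡ p - 1ℚ → a ≡ x - 1ℚ → b ≡ p * x - 1ℚ → p * (b - a) ≡ m * (b + 1ℚ)
  step p x refl refl refl = solve 2
    (λ p x → p :* ((p :* x :- con 1ℚ) :- (x :- con 1ℚ))
          := (p :- con 1ℚ) :* ((p :* x :- con 1ℚ) :+ con 1ℚ)) refl p x

-- The inverse `c` of `m` is an indeterminate for the ring solver; beyond ring laws and `h`, only
-- `m * c ≡ 1ℚ` enters.
÷-difference : ∀ p a b m s .{{_ : ℚ.NonZero m}} → p * (b - a) ≡ m * (b + 1ℚ) →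
  (p * (b ÷ m) - (1ℚ + s)) ÷ m - (p * (a ÷ m) - s) ÷ m ≡ b ÷ m
÷-difference p a b m s h = begin
  (p * (b * c) - (1ℚ + s)) * c - (p * (a * c) - s) * c
    ≡⟨ solve 5 (λ p a b c s →
         (p :* (b :* c) :- (con 1ℚ :+ s)) :* c :- (p :* (a :* c) :- s) :* c
         := p :* (b :- a) :* c :* c :- c) refl p a b c s ⟩
  p * (b - a) * c * c - c
    ≡⟨ cong (λ x → x * c * c - c) h ⟩
  m * (b + 1ℚ) * c * c - c
    ≡⟨ solve 3 (λ m b c → m :* (b :+ con 1ℚ) :* c :* c :- c
         := (m :* c) :* ((b :+ con 1ℚ) :* c) :- c) refl m b c ⟩
  (m * c) * ((b + 1ℚ) * c) - c
    ≡⟨ cong (λ x → x * ((b + 1ℚ) * c) - c) (ℚ.*-inverseʳ m) ⟩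
  1ℚ * ((b + 1ℚ) * c) - c
    ≡⟨ solve 2 (λ b c → con 1ℚ :* ((b :+ con 1ℚ) :* c) :- c := b :* c) refl b c ⟩
  b * c ∎
  where
  c = 1/ m

theorem2p17 : (k n : ℕ) .{{_ : ℕ.NonZero k}} .{{_ : ℕ.NonZero n}} →
    ∑[ i < n ] M⁽ k ⁾ (suc (toℕ i)) ≡
    ((fromℤ (+ (2 ℕ.^ k)) * M⁽ k ⁾ n - fromℤ (+ n)) ÷ fromℤ (M k)) {{M-nonZero k}}
theorem2p17 k n = begin
  ∑[ i < n ] M⁽ k ⁾ (suc (toℕ i))              ≡⟨ sum-cong-≗ {n} (λ i → G-step (toℕ i)) ⟨
  ∑[ i < n ] (G (suc (toℕ i)) - G (toℕ i))     ≡⟨ ∑-telescope G n ⟩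
  G n - G 0                                    ≡⟨ cong (_-_ (G n)) G-zero ⟩
  G n - 0ℚ                                     ≡⟨ ℚ.+-identityʳ (G n) ⟩
  G n                                          ∎
  where
  p = fromℤ (+ (2 ℕ.^ k))
  m = fromℤ (M k)
  instance
    m≢0 : ℚ.NonZero m
    m≢0 = M-nonZero k

  G : ℕ → ℚ
  G j = (p * M⁽ k ⁾ j - fromℤ (+ j)) ÷ m

  G-step : ∀ j → G (suc j) - G j ≡ M⁽ k ⁾ (suc j)
  G-step j = begin
    G (suc j) - G j
      -- `+ suc j` is `1ℤ ℤ.+ + j` by computation, and `fromℤ 1ℤ` is `1ℚ`.
      ≡⟨ cong (λ s → (p * M⁽ k ⁾ (suc j) - s) ÷ m - G j) (fromℤ-+ 1ℤ (+ j)) ⟩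
    (p * M⁽ k ⁾ (suc j) - (1ℚ + fromℤ (+ j))) ÷ m - G j
      ≡⟨ ÷-difference p (fromℤ (M (k ℕ.* j))) (fromℤ (M (k ℕ.* suc j))) m (fromℤ (+ j)) (M-step k j) ⟩
    M⁽ k ⁾ (suc j) ∎

  G-zero : G 0 ≡ 0ℚ
  G-zero = begin
    (p * (fromℤ (M (k ℕ.* 0)) * 1/ m) - 0ℚ) * 1/ m
      -- `k ℕ.* 0` is stuck on the variable `k`; once it is rewritten to 0, `M 0` computes to zero.
      ≡⟨ cong (λ e → (p * (fromℤ (M e) * 1/ m) - 0ℚ) * 1/ m) (ℕ.*-zeroʳ k) ⟩
    (p * (0ℚ * 1/ m) - 0ℚ) * 1/ m
      ≡⟨ solve 2 (λ p c → (p :* (con 0ℚ :* c) :- con 0ℚ) :* c := con 0ℚ) refl p (1/ m) ⟩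
    0ℚ ∎
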